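{- A lattice is modular if and only if it satisfies the inequality $$\bigvee_{\pi}\bigl(x\wedge(z\vee(x\wedge y))\bigr)\leq\bigwedge_{\pi}\bigl(x\vee(z\wedge(x\vee y))\bigr)$$ for all values of the variables $x,y,z$ in the lattice.
   Context: For a lattice term $t$ in the variables $x,y,z$, $\bigvee_\pi t$ (resp. $\bigwedge_\pi t$) denotes the join (resp. meet) of the six terms obtained from $t$ by applying all permutations of the variables $x,y,z$ to it. -}

module Defs where

open import Level using (Level; _⊔_)
open import Relation.Binary.Lattice using (Lattice)

private
  variable
    a c ℓ₁ ℓ₂ : Level

Modular : Lattice c ℓ₁ ℓ₂ → Set (c ⊔ ℓ₁ ⊔ ℓ₂)
Modular L = ∀ a b c → a ≤ c → a ∨ (b ∧ c) ≈ (a ∨ b) ∧ c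
  where open Lattice L

data Var : Set where
  x y z : Var

infixr 6 _∨_
infixr 7 _∧_

data Term : Set where
  var : Var → Term
  _∨_ : Term → Term → Term
  _∧_ : Term → Term → Term

-- The function on variables sending x, y, z to the three arguments in order.
⟨_,_,_⟩ : {A : Set a} → A → A → A → Var → A
⟨ p , q , r ⟩ x = p
⟨ p , q , r ⟩ y = q
⟨ p , q , r ⟩ z = r

rename : (Var → Var) → Term → Term
rename σ (var v) = var (σ v)
rename σ (s ∨ t) = rename σ s ∨ rename σ t
rename σ (s ∧ t) = rename σ s ∧ rename σ t

⋁π : Term → Term
⋁π t = rename ⟨ x , y , z ⟩ t ∨ rename ⟨ x , z , y ⟩ t
     ∨ rename ⟨ y , x , z ⟩ t ∨ rename ⟨ y , z , x ⟩ t
     ∨ rename ⟨ z , x , y ⟩ t ∨ rename ⟨ z , y , x ⟩ t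

⋀π : Term → Term
⋀π t = rename ⟨ x , y , z ⟩ t ∧ rename ⟨ x , z , y ⟩ t
     ∧ rename ⟨ y , x , z ⟩ t ∧ rename ⟨ y , z , x ⟩ t
     ∧ rename ⟨ z , x , y ⟩ t ∧ rename ⟨ z , y , x ⟩ t

module _ (L : Lattice c ℓ₁ ℓ₂) where
  private module L = Lattice L

  eval : (Var → L.Carrier) → Term → L.Carrier
  eval ρ (var v) = ρ v
  eval ρ (s ∨ t) = eval ρ s L.∨ eval ρ t
  eval ρ (s ∧ t) = eval ρ s L.∧ eval ρ t

  infix 4 _⊨_≤_

  _⊨_≤_ : Term → Term → Set (c ⊔ ℓ₂)
  _⊨_≤_ s t = ∀ ρ → eval ρ s L.≤ eval ρ t

{-# OPTIONS --safe #-}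
-- In a modular lattice the two terms equal (x ∧ y) ∨ (x ∧ z) and
-- (x ∨ y) ∧ (x ∨ z), so the left-hand side lies below the lower median
-- (x ∧ y) ∨ (x ∧ z) ∨ (y ∧ z) and the right-hand side above the upper median
-- (x ∨ y) ∧ (x ∨ z) ∧ (y ∨ z); the lower median lies below the upper one because
-- any two pairs of variables share a variable. Conversely, for a ≤ c one joinand
-- evaluates to c ∧ (b ∨ a) and one meetand to a ∨ (b ∧ c).
module Submission where

open import Defs
open import Function.Bundles using (_⇔_; mk⇔)
open import Relation.Binary.Lattice using (Lattice)
import Relation.Binary.Lattice.Properties.JoinSemilattice as JoinProperties
import Relation.Binary.Lattice.Properties.MeetSemilattice as MeetProperties

module _ {c ℓ₁ ℓ₂} (L : Lattice c ℓ₁ ℓ₂) where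
  open Lattice L renaming (_∨_ to infixr 6 _⊔_; _∧_ to infixr 7 _⊓_)
  open JoinProperties joinSemilattice
    using () renaming (∨-comm to ⊔-comm; ∨-monotonic to ⊔-monotonic)
  open MeetProperties meetSemilattice
    using () renaming (∧-comm to ⊓-comm; ∧-monotonic to ⊓-monotonic)

  lowerMedian upperMedian : Carrier → Carrier → Carrier → Carrier
  lowerMedian p q r = (p ⊓ q) ⊔ (p ⊓ r) ⊔ (q ⊓ r)
  upperMedian p q r = (p ⊔ q) ⊓ (p ⊔ r) ⊓ (q ⊔ r)

  lowerMedian≤upperMedian : ∀ p q r → lowerMedian p q r ≤ upperMedian p q r
  lowerMedian≤upperMedian p q r =
    ∨-least
      (below (trans p⊓q≤p (x≤x∨y _ _)) (trans p⊓q≤p (x≤x∨y _ _))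
             (trans (x∧y≤y _ _) (x≤x∨y _ _)))
      (∨-least
        (below (trans p⊓r≤p (x≤x∨y _ _)) (trans p⊓r≤p (x≤x∨y _ _))
               (trans (x∧y≤y _ _) (y≤x∨y _ _)))
        (below (trans (x∧y≤x _ _) (y≤x∨y _ _)) (trans (x∧y≤y _ _) (y≤x∨y _ _))
               (trans (x∧y≤x _ _) (x≤x∨y _ _))))
    where
    p⊓q≤p = x∧y≤x p q
    p⊓r≤p = x∧y≤x p r

    below : ∀ {s} → s ≤ p ⊔ q → s ≤ p ⊔ r → s ≤ q ⊔ r → s ≤ upperMedian p q r
    below h₁ h₂ h₃ = ∧-greatest h₁ (∧-greatest h₂ h₃)

  module _ (modular : Modular L) where

    -- Modularity along `p ⊓ q ≤ p` splits the joinand into `(p ⊓ q) ⊔ (r ⊓ p)`, so it is enough to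
    -- bound these two meets. The bound `u` is left arbitrary so that one argument serves all six
    -- permutations.
    modular⇒joinand≤ : ∀ {p q r u} → p ⊓ q ≤ u → p ⊓ r ≤ u → p ⊓ (r ⊔ (p ⊓ q)) ≤ u
    modular⇒joinand≤ {p} {q} {r} pq pr =
      trans (∧-greatest (trans (x∧y≤y _ _) (reflexive (⊔-comm _ _))) (x∧y≤x _ _))
        (trans (reflexive (Eq.sym (modular (p ⊓ q) r p (x∧y≤x p q))))
          (∨-least pq (trans (reflexive (⊓-comm r p)) pr)))

    -- Dual splitting, along `p ≤ p ⊔ q`: the meetand equals `(p ⊔ r) ⊓ (p ⊔ q)`.
    modular⇒≤meetand : ∀ {p q r u} → u ≤ p ⊔ q → u ≤ p ⊔ r → u ≤ p ⊔ (r ⊓ (p ⊔ q))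
    modular⇒≤meetand {p} {q} {r} pq pr =
      trans (∧-greatest pr pq)
        (reflexive (Eq.sym (modular p r (p ⊔ q) (x≤x∨y p q))))

    modular⇒⋁π≤lowerMedian : ∀ ρ →
      eval L ρ (⋁π (var x ∧ (var z ∨ (var x ∧ var y)))) ≤ lowerMedian (ρ x) (ρ y) (ρ z)
    modular⇒⋁π≤lowerMedian ρ =
      -- Each permutation asks for the meets of its leading variable with the other two; up to
      -- commutativity these are among the three joinands of `m`.
      ∨-least (modular⇒joinand≤ xy xz) (∨-least (modular⇒joinand≤ xz xy)
        (∨-least (modular⇒joinand≤ (swap xy) yz) (∨-least (modular⇒joinand≤ yz (swap xy))
          (∨-least (modular⇒joinand≤ (swap xz) (swap yz))
                   (modular⇒joinand≤ (swap yz) (swap xz))))))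
      where
      m = lowerMedian (ρ x) (ρ y) (ρ z)

      swap : ∀ {p q} → p ⊓ q ≤ m → q ⊓ p ≤ m
      swap = trans (reflexive (⊓-comm _ _))

      xy : ρ x ⊓ ρ y ≤ m
      xy = x≤x∨y _ _

      xz : ρ x ⊓ ρ z ≤ m
      xz = trans (x≤x∨y _ _) (y≤x∨y _ _)

      yz : ρ y ⊓ ρ z ≤ m
      yz = trans (y≤x∨y _ _) (y≤x∨y _ _)

    modular⇒upperMedian≤⋀π : ∀ ρ →
      upperMedian (ρ x) (ρ y) (ρ z) ≤ eval L ρ (⋀π (var x ∨ (var z ∧ (var x ∨ var y))))
    modular⇒upperMedian≤⋀π ρ =
      ∧-greatest (modular⇒≤meetand xy xz) (∧-greatest (modular⇒≤meetand xz xy)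
        (∧-greatest (modular⇒≤meetand (swap xy) yz) (∧-greatest (modular⇒≤meetand yz (swap xy))
          (∧-greatest (modular⇒≤meetand (swap xz) (swap yz))
                      (modular⇒≤meetand (swap yz) (swap xz))))))
      where
      m = upperMedian (ρ x) (ρ y) (ρ z)

      swap : ∀ {p q} → m ≤ p ⊔ q → m ≤ q ⊔ p
      swap h = trans h (reflexive (⊔-comm _ _))

      xy : m ≤ ρ x ⊔ ρ y
      xy = x∧y≤x _ _

      xz : m ≤ ρ x ⊔ ρ z
      xz = trans (x∧y≤y _ _) (x∧y≤x _ _)

      yz : m ≤ ρ y ⊔ ρ z
      yz = trans (x∧y≤y _ _) (x∧y≤y _ _)

  inequality⇒modular :
    L ⊨ ⋁π (var x ∧ (var z ∨ (var x ∧ var y))) ≤ ⋀π (var x ∨ (var z ∧ (var x ∨ var y))) →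
    Modular L
  inequality⇒modular ineq a b c a≤c = antisym
    -- This direction holds in every lattice, given `a ≤ c`.
    (∨-least (∧-greatest (x≤x∨y _ _) a≤c)
             (⊓-monotonic (y≤x∨y _ _) refl))
    (trans (∧-greatest (x∧y≤y _ _) (trans (x∧y≤x _ _) a⊔b≤b⊔[c⊓a]))
      -- The element is now below `c ⊓ (b ⊔ (c ⊓ a))`, the joinand of the identity permutation under
      -- `x ↦ c`, `y ↦ a`, `z ↦ b`.
      (trans (x≤x∨y _ _)
        (trans (ineq ⟨ c , a , b ⟩)
          -- The projections select the third meetand, which exchanges `x` and `y`:
          -- `a ⊔ (b ⊓ (a ⊔ c))`. Its inner `a ⊔ c` then shrinks to `c`.
          (trans (trans (x∧y≤y _ _) (trans (x∧y≤y _ _) (x∧y≤x _ _)))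
            (⊔-monotonic refl (⊓-monotonic refl (∨-least a≤c refl)))))))
    where
    -- The joinand contains `c ⊓ a` where `a` is wanted; `a ≤ c` gives `a ≤ c ⊓ a`.
    a⊔b≤b⊔[c⊓a] : a ⊔ b ≤ b ⊔ (c ⊓ a)
    a⊔b≤b⊔[c⊓a] = ∨-least (trans (∧-greatest a≤c refl) (y≤x∨y _ _)) (x≤x∨y _ _)

theorem14 : ∀ {c ℓ₁ ℓ₂} (L : Lattice c ℓ₁ ℓ₂) →
    Modular L ⇔
    (L ⊨ ⋁π (var x ∧ (var z ∨ (var x ∧ var y)))
    ≤ ⋀π (var x ∨ (var z ∧ (var x ∨ var y))))
theorem14 L = mk⇔
  (λ modular ρ → trans (modular⇒⋁π≤lowerMedian L modular ρ)
    (trans (lowerMedian≤upperMedian L (ρ x) (ρ y) (ρ z)) (modular⇒upperMedian≤⋀π L modular ρ)))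
  (inequality⇒modular L)
  where open Lattice L using (trans)
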